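{- Let $\phi,\psi:A\to L\{\tau\}$ be two rank $r$ Drinfeld $A$-modules over the finite $A$-field $L$ defined by $$\phi_T=\gamma(T)+g_1\tau+\cdots+g_r\tau^r\quad\text{and}\quad\psi_T=\gamma(T)+g_1'\tau+\cdots+g_r'\tau^r.$$ The following are equivalent: (i) $\phi$ and $\psi$ are isomorphic over $L$; (ii) $\phi$ and $\psi$ are isomorphic over $L^{sep}$ and there exists $\lambda\in B$ with $FI_\lambda(\phi)=FI_\lambda(\psi)$; (iii) $\phi$ and $\psi$ are isomorphic over $L^{sep}$ and $FI(\phi)=FI(\psi)$.
   Context: $A=\mathbb{F}_q[T]$; $L$ is a finite $A$-field, i.e. a finite field with an $\mathbb{F}_q$-algebra homomorphism $\gamma:A\to L$; $L^{sep}$ is a separable closure of $L$. $L\{\tau\}$ is the ring of $\mathbb{F}_q$-linear polynomials over $L$ under composition, where $\tau(x)=x^q$ (so $\tau a=a^q\tau$ for $a\in L$). A Drinfeld $A$-module of rank $r$ over $L$ is an $\mathbb{F}_q$-algebra homomorphism $\phi:A\to L\{\tau\}$, determined by $\phi_T=\gamma(T)+g_1\tau+\cdots+g_r\tau^r$ with $g_i\in L$, $g_r\ne0$. For a field $K\supseteq L$, $\phi$ and $\psi$ are isomorphic over $K$ if there is $x\in K^*$ with $\psi_T=x^{ -1}\phi_Tx$, i.e. $g_k'=g_kx^{q^k-1}$ for all $k$. Fine isomorphy invariant of $\phi$: put $I=\{i\in\{1,\dots,r\}: g_i\neq0\}$, $d=\gcd(q^k-1: k\in I)$ $(=q^{\delta}-1$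 with $\delta=\gcd(k:k\in I))$, and $B=\{\lambda=(\lambda_k)_{k\in I}\in\mathbb{Z}^I: d=\sum_{k\in I}\lambda_k(q^k-1)\}$. For $\lambda\in B$ let $FI_\lambda(\phi)$ be the class of $\prod_{k\in I}g_k^{\lambda_k}$ in $L^*/L^{*d}$, where $L^{*d}$ is the group of $d$-th powers in $L^*$. Then $FI(\phi)=(FI_\lambda(\phi))_{\lambda\in B}$. (When $\phi$ and $\psi$ are isomorphic over $L^{sep}$ they have the same $I$, $d$ and $B$.) -}

module Defs where

open import Algebra.Apartness.Bundles using (HeytingCommutativeRing; HeytingField)
open import Algebra.Bundles using (AbelianGroup; CommutativeRing; Group; RawRing)
open import Algebra.Morphism.Structures using (IsRingHomomorphism)
import Algebra.Apartness.Properties.HeytingCommutativeRing as HeytingProperties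
import Algebra.Definitions.RawMonoid as Multiples
import Algebra.Definitions.RawSemiring as Powers
import Algebra.Morphism.Construct.Identity as Identity
import Algebra.Properties.CommutativeMonoid.Mult as CommutativeMultiples
open import Data.Fin.Base using (Fin)
import Data.Fin.Properties as Fin
open import Data.Integer.Base as ℤ using (ℤ; +_; -[1+_])
open import Data.List.Base using (List; []; _∷_; applyUpTo; filter; foldr; map)
open import Data.List.Membership.Propositional using (_∈_; _∉_)
open import Data.List.Relation.Unary.All using (reduce)
open import Data.List.Relation.Unary.All.Properties using (all-filter)
open import Data.Nat.Base as ℕ using (ℕ; zero; suc; _<_; _≤_; _∸_)
open import Data.Nat.GCD using (gcd)
open import Data.Product.Base using (Σ; ∃; _×_; _,_; proj₁; proj₂)
open import Function.Base using (_on_; id)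
open import Function.Bundles using (Inverse; _⇔_)
open import Level using (Level; _⊔_) renaming (suc to lsuc)
open import Relation.Binary.Bundles using (Setoid)
open import Relation.Binary.PropositionalEquality as ≡ using (_≡_)
import Relation.Binary.Reasoning.Setoid as SetoidReasoning
open import Relation.Nullary.Decidable using (Dec; yes; no)

private
  variable
    a b c ℓ ℓ₁ ℓ₂ m₁ m₂ : Level

-- Skew polynomials R[X;σ], with X a = σ(a) X.  A list [a₀, a₁, …]
-- stands for Σ aᵢ Xⁱ, and equality is equality of all coefficients, so
-- that trailing zeros are immaterial.

module SkewPolynomial (R : RawRing c ℓ)
                      (σ : RawRing.Carrier R → RawRing.Carrier R) where

  private module R = RawRing R

  Poly : Set c
  Poly = List R.Carrier

  coeff : Poly → ℕ → R.Carrier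
  coeff []      _       = R.0#
  coeff (a ∷ f) zero    = a
  coeff (a ∷ f) (suc k) = coeff f k

  C : R.Carrier → Poly
  C a = a ∷ []

  X : Poly
  X = R.0# ∷ R.1# ∷ []

  infix  4 _≈_
  infixl 6 _+_
  infixl 7 _*_

  _≈_ : Poly → Poly → Set ℓ
  f ≈ g = ∀ k → coeff f k R.≈ coeff g k

  _+_ : Poly → Poly → Poly
  []      + g       = g
  (a ∷ f) + []      = a ∷ f
  (a ∷ f) + (b ∷ g) = (a R.+ b) ∷ (f + g)

  -- (a + f X) g = a g + f (X g), where X (Σ bⱼ Xʲ) = Σ σ(bⱼ) Xʲ⁺¹.
  _*_ : Poly → Poly → Poly
  []      * g = []
  (a ∷ f) * g = map (a R.*_) g + f * (R.0# ∷ map σ g)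

  rawRing : RawRing c ℓ
  rawRing = record
    { Carrier = Poly
    ; _≈_     = _≈_
    ; _+_     = _+_
    ; _*_     = _*_
    ; -_      = map (R.-_)
    ; 0#      = []
    ; 1#      = C R.1#
    }

-- Fields.  The library's HeytingField is used, and "x ≠ 0" is rendered
-- by the apartness x # 0, i.e. by invertibility of x; classically this
-- is the same as the negation of x ≈ 0.

fieldRing : HeytingField c ℓ₁ ℓ₂ → RawRing c ℓ₁
fieldRing K = CommutativeRing.rawRing
  (HeytingCommutativeRing.commutativeRing (HeytingField.heytingCommutativeRing K))

module _ (K : HeytingField c ℓ₁ ℓ₂) where

  open HeytingField K
  open HeytingProperties heytingCommutativeRing
  open SetoidReasoning setoid

  private
    inv : ∀ {x} → x # 0# → Carrier
    inv x#0 = proj₁ (#⇒invertible x#0)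

    invˡ : ∀ {x} (x#0 : x # 0#) → inv x#0 * x ≈ 1#
    invˡ {x} x#0 = trans (*-congˡ (sym (x-0≈x x))) (proj₁ (proj₂ (#⇒invertible x#0)))

    invʳ : ∀ {x} (x#0 : x # 0#) → x * inv x#0 ≈ 1#
    invʳ x#0 = trans (*-comm _ _) (invˡ x#0)

    invertible⇒#0 : ∀ {x y} → y * x ≈ 1# → x # 0#
    invertible⇒#0 {x} {y} yx≈1 =
      invertibleˡ⇒# (y , trans (*-congˡ (x-0≈x x)) yx≈1)

  infix 9 _ˣ

  -- The multiplicative group K*.
  _ˣ : AbelianGroup (c ⊔ ℓ₂) ℓ₁
  _ˣ = record
    { Carrier = Σ Carrier (_# 0#)
    ; _≈_     = _≈_ on proj₁
    ; _∙_     = λ (x , x#0) (y , y#0) → x * y , x#0y#0→xy#0 x#0 y#0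
    ; ε       = 1# , 1#0
    ; _⁻¹     = λ (x , x#0) → inv x#0 , invertible⇒#0 (invʳ x#0)
    ; isAbelianGroup = record
      { isGroup = record
        { isMonoid = record
          { isSemigroup = record
            { isMagma = record
              { isEquivalence = record { refl = refl ; sym = sym ; trans = trans }
              ; ∙-cong        = *-cong
              }
            ; assoc = λ _ _ _ → *-assoc _ _ _
            }
          ; identity = (λ _ → *-identityˡ _) , (λ _ → *-identityʳ _)
          }
        ; inverse = (λ (_ , x#0) → invˡ x#0) , (λ (_ , x#0) → invʳ x#0)
        ; ⁻¹-cong = λ {(_ , x#0)} {(_ , y#0)} → inv-cong x#0 y#0
        }
      ; comm = λ _ _ → *-comm _ _
      }
    }
    where
    inv-cong : ∀ {x y} (x#0 : x # 0#) (y#0 : y # 0#) → x ≈ y → inv x#0 ≈ inv y#0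
    inv-cong {x} {y} x#0 y#0 x≈y = begin
      inv x#0                 ≈⟨ *-identityʳ _ ⟨
      inv x#0 * 1#            ≈⟨ *-congˡ (invʳ y#0) ⟨
      inv x#0 * (y * inv y#0) ≈⟨ *-assoc _ _ _ ⟨
      (inv x#0 * y) * inv y#0 ≈⟨ *-congʳ (*-congˡ x≈y) ⟨
      (inv x#0 * x) * inv y#0 ≈⟨ *-congʳ (invˡ x#0) ⟩
      1# * inv y#0            ≈⟨ *-identityˡ _ ⟩
      inv y#0                 ∎

  record IsFinite (n : ℕ) : Set (c ⊔ ℓ₁) where
    field
      enumeration : Inverse setoid (≡.setoid (Fin n))

    open Inverse enumeration

    -- Invertibility is decided by searching for an inverse.
    _#0? : ∀ x → Dec (x # 0#)
    x #0? with Fin.any? (λ i → to (from i * x) Fin.≟ to 1#)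
    ... | yes (i , eq) = yes (invertible⇒#0 (to-injective eq))
      where
      to-injective : ∀ {y z} → to y ≡ to z → y ≈ z
      to-injective {y} {z} eq′ = begin
        y            ≈⟨ inverseʳ ≡.refl ⟨
        from (to y)  ≈⟨ from-cong eq′ ⟩
        from (to z)  ≈⟨ inverseʳ ≡.refl ⟩
        z            ∎
    ... | no ¬inv = no λ x#0 →
      ¬inv (to (inv x#0) , to-cong (trans (*-congʳ (inverseʳ ≡.refl)) (invˡ x#0)))

record FiniteField c ℓ₁ ℓ₂ : Set (lsuc (c ⊔ ℓ₁ ⊔ ℓ₂)) where
  field
    heytingField : HeytingField c ℓ₁ ℓ₂
    order        : ℕ
    isFinite     : IsFinite heytingField order

  open HeytingField heytingField public
  open IsFinite isFinite public using (_#0?)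

module _ (G : Group c ℓ) where

  open Group G
  open Multiples rawMonoid using () renaming (_×_ to _×ᴳ_)

  -- The power xⁿ for n ∈ ℤ; n ×ᴳ x is the library's x ∙ ⋯ ∙ x.
  zpow : Carrier → ℤ → Carrier
  zpow x (+ n)    = n ×ᴳ x
  zpow x -[1+ n ] = (suc n ×ᴳ x) ⁻¹

-- The quotient G / Gᵈ of G by its subgroup of d-th powers.
_modPowers_ : AbelianGroup c ℓ → ℕ → Setoid c (c ⊔ ℓ)
G modPowers d = record
  { Carrier       = Carrier
  ; _≈_           = λ x y → ∃ λ z → x ≈ y ∙ d ×ᴳ z
  ; isEquivalence = record
    { refl  = λ {x} → ε , (begin
        x              ≈⟨ identityʳ x ⟨
        x ∙ ε          ≈⟨ ∙-congˡ (×ε d) ⟨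
        x ∙ d ×ᴳ ε     ∎)
    ; sym   = λ {x} {y} (z , x≈yzᵈ) → z ⁻¹ , (begin
        y                             ≈⟨ identityʳ y ⟨
        y ∙ ε                         ≈⟨ ∙-congˡ (×ε d) ⟨
        y ∙ d ×ᴳ ε                    ≈⟨ ∙-congˡ (×-congʳ d (inverseʳ z)) ⟨
        y ∙ d ×ᴳ (z ∙ z ⁻¹)           ≈⟨ ∙-congˡ (×-distrib-+ z (z ⁻¹) d) ⟩
        y ∙ (d ×ᴳ z ∙ d ×ᴳ (z ⁻¹))    ≈⟨ assoc _ _ _ ⟨
        (y ∙ d ×ᴳ z) ∙ d ×ᴳ (z ⁻¹)    ≈⟨ ∙-congʳ x≈yzᵈ ⟨
        x ∙ d ×ᴳ (z ⁻¹)               ∎)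
    ; trans = λ {w} {x} {y} (z , w≈xzᵈ) (z′ , x≈yz′ᵈ) → z′ ∙ z , (begin
        w                             ≈⟨ w≈xzᵈ ⟩
        x ∙ d ×ᴳ z                    ≈⟨ ∙-congʳ x≈yz′ᵈ ⟩
        (y ∙ d ×ᴳ z′) ∙ d ×ᴳ z        ≈⟨ assoc _ _ _ ⟩
        y ∙ (d ×ᴳ z′ ∙ d ×ᴳ z)        ≈⟨ ∙-congˡ (×-distrib-+ z′ z d) ⟨
        y ∙ d ×ᴳ (z′ ∙ z)             ∎)
    }
  }
  where
  open AbelianGroup G
  open CommutativeMultiples commutativeMonoid using (×-distrib-+; ×-congʳ)
  open Multiples rawMonoid using () renaming (_×_ to infixr 8 _×ᴳ_)
  open SetoidReasoning (AbelianGroup.setoid G)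

  ×ε : ∀ n → n ×ᴳ ε ≈ ε
  ×ε zero    = refl
  ×ε (suc n) = trans (identityˡ _) (×ε n)

module Polynomial (K : HeytingField c ℓ₁ ℓ₂) where

  open HeytingField K using (Carrier; _#_; 0#; 1#)
    renaming (_≈_ to _≈ᴷ_; _+_ to _+ᴷ_; _*_ to _*ᴷ_)
  open SkewPolynomial (fieldRing K) id public

  eval : Poly → Carrier → Carrier
  eval f x = foldr (λ a y → a +ᴷ x *ᴷ y) 0# f

  -- (a + f X)′ = f + f′ X.
  derivative : Poly → Poly
  derivative []      = []
  derivative (a ∷ f) = f + (0# ∷ derivative f)

  NonConstant : Poly → Set ℓ₂
  NonConstant f = ∃ λ k → 0 < k × coeff f k # 0#

  -- f and f′ are coprime, i.e. f has no multiple root in any extension.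
  Separable : Poly → Set (c ⊔ ℓ₁)
  Separable f = ∃ λ u → ∃ λ v → u * f + v * derivative f ≈ C 1#

record Extension (K : HeytingField c ℓ₁ ℓ₂) a m₁ m₂
       : Set (c ⊔ ℓ₁ ⊔ lsuc (a ⊔ m₁ ⊔ m₂)) where
  field
    extField : HeytingField a m₁ m₂
    ι        : HeytingField.Carrier K → HeytingField.Carrier extField
    ι-isHom  : IsRingHomomorphism (fieldRing K) (fieldRing extField) ι

trivialExtension : (K : HeytingField c ℓ₁ ℓ₂) → Extension K c ℓ₁ ℓ₂
trivialExtension K = record
  { extField = K
  ; ι        = id
  ; ι-isHom  = Identity.isRingHomomorphism (fieldRing K) (HeytingField.refl K)
  }

-- An element is separable over K when it is a root of a separable
-- polynomial over K: as divisors of separable polynomials are separable,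
-- this says that its minimal polynomial is separable.
record SeparableClosure (K : HeytingField c ℓ₁ ℓ₂) a m₁ m₂
       : Set (c ⊔ ℓ₁ ⊔ lsuc (a ⊔ m₁ ⊔ m₂)) where
  field
    extension : Extension K a m₁ m₂

  open Extension extension public

  private
    module E  = HeytingField extField
    module PK = Polynomial K
    module PE = Polynomial extField

  field
    separable       : ∀ x → ∃ λ f → PK.Separable f × PE.eval (map ι f) x E.≈ E.0#
    separablyClosed : ∀ f → PE.NonConstant f → PE.Separable f →
                      ∃ λ x → PE.eval f x E.≈ E.0#

-- A finite A-field for A = 𝔽[T].  (The polynomial ring A is the skew
-- polynomial ring with trivial twist.)
record FiniteAField (𝔽 : FiniteField a m₁ m₂) c ℓ₁ ℓ₂
       : Set (a ⊔ m₁ ⊔ m₂ ⊔ lsuc (c ⊔ ℓ₁ ⊔ ℓ₂)) where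

  private
    module 𝔽 = FiniteField 𝔽
    module A = Polynomial 𝔽.heytingField

  field
    finiteField : FiniteField c ℓ₁ ℓ₂

  open FiniteField finiteField public

  field
    scalar       : 𝔽.Carrier → Carrier
    scalar-isHom : IsRingHomomorphism (fieldRing 𝔽.heytingField) (fieldRing heytingField) scalar
    γ            : A.Poly → Carrier
    γ-isHom      : IsRingHomomorphism A.rawRing (fieldRing heytingField) γ
    γ-scalar     : ∀ x → γ (A.C x) ≈ scalar x

-- K{τ}, with τ a = a^q τ; Σ aᵢ τⁱ is the q-linear polynomial Σ aᵢ x^(qⁱ)
-- and multiplication is composition.
module Twisted (q : ℕ) (K : HeytingField c ℓ₁ ℓ₂) where

  open Powers (RawRing.rawSemiring (fieldRing K)) using (_^_)
  open SkewPolynomial (fieldRing K) (_^ q) public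

module _ {𝔽 : FiniteField a m₁ m₂} (L : FiniteAField 𝔽 c ℓ₁ ℓ₂) where

  private
    module 𝔽  = FiniteField 𝔽
    module A  = Polynomial 𝔽.heytingField
    module L  = FiniteAField L
    module Lτ = Twisted 𝔽.order L.heytingField

  record DrinfeldModule (r : ℕ) : Set (a ⊔ m₁ ⊔ c ⊔ ℓ₁ ⊔ ℓ₂) where
    field
      φ        : A.Poly → Lτ.Poly
      φ-isHom  : IsRingHomomorphism A.rawRing Lτ.rawRing φ
      φ-scalar : ∀ x → φ (A.C x) Lτ.≈ Lτ.C (L.scalar x)

    φT : Lτ.Poly
    φT = φ A.X

    -- φ_T = g₀ + g₁ τ + g₂ τ² + ⋯
    g : ℕ → L.Carrier
    g = Lτ.coeff φT

    field
      constantTerm : g 0 L.≈ L.γ A.X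
      leadingTerm  : g r L.# L.0#
      degree       : ∀ k → r < k → g k L.≈ L.0#

module _ {𝔽 : FiniteField a m₁ m₂} {L : FiniteAField 𝔽 c ℓ₁ ℓ₂} where

  private
    module L = FiniteAField L

    q : ℕ
    q = FiniteField.order 𝔽

  -- ψ_T = x⁻¹ φ_T x in K{τ} for some x ∈ K*.
  IsomorphicOver : ∀ {b m₁ m₂} → Extension L.heytingField b m₁ m₂ →
                   ∀ {r} → DrinfeldModule L r → DrinfeldModule L r → Set (b ⊔ m₁ ⊔ m₂)
  IsomorphicOver E φ ψ =
    ∃ λ (x : Carrier) → map ι (φT ψ) ≈ C (proj₁ (x ⁻¹)) * map ι (φT φ) * C (proj₁ x)
    where
    open Extension E
    open AbelianGroup (extField ˣ) using (Carrier; _⁻¹)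
    open Twisted q extField using (_≈_; _*_; C)
    open DrinfeldModule using (φT)

  module _ {r : ℕ} (φ : DrinfeldModule L r) where

    open DrinfeldModule φ using (g)

    -- I = { k ∈ {1,…,r} : gₖ ≠ 0 }, in increasing order.
    I : List ℕ
    I = filter (λ k → g k L.#0?) (applyUpTo suc r)

    d : ℕ
    d = foldr gcd 0 (map (λ k → q ℕ.^ k ∸ 1) I)

    -- An element of ℤᴵ is encoded as a function ℕ → ℤ vanishing outside I.
    record InB (λs : ℕ → ℤ) : Set where
      field
        support : ∀ k → k ∉ I → λs k ≡ + 0
        bezout  : + d ≡ foldr ℤ._+_ (+ 0) (map (λ k → λs k ℤ.* + (q ℕ.^ k ∸ 1)) I)

    -- The product of the gₖ^λₖ over k ∈ I; it is a representative in L*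
    -- of the class FI_λ(φ) in L*/L*ᵈ.
    FI : (ℕ → ℤ) → AbelianGroup.Carrier (L.heytingField ˣ)
    FI λs = foldr _∙_ ε
      (reduce (λ {k} gₖ#0 → zpow group (g k , gₖ#0) (λs k))
              (all-filter (λ k → g k L.#0?) (applyUpTo suc r)))
      where open AbelianGroup (L.heytingField ˣ) using (_∙_; ε; group)

  module _ {r : ℕ} (φ ψ : DrinfeldModule L r) where

    -- FI_λ(φ) = FI_λ(ψ) in L*/L*ᵈ.  Here d is that of φ: the comparison is
    -- only made for φ and ψ isomorphic over a separable closure, and these
    -- have the same d.
    SameFIAt : (ℕ → ℤ) → Set (c ⊔ ℓ₁ ⊔ ℓ₂)
    SameFIAt λs = FI φ λs ≈ FI ψ λs
      where open Setoid ((L.heytingField ˣ) modPowers d φ) using (_≈_)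

    -- Equality of families: equal index sets B and equal values.
    SameFI : Set (c ⊔ ℓ₁ ⊔ ℓ₂)
    SameFI = (∀ λs → InB φ λs ⇔ InB ψ λs) × (∀ λs → InB φ λs → SameFIAt λs)

{-# OPTIONS --safe #-}

-- Comparing coefficients, ψ_T = x⁻¹ φ_T x says that gₖ′ = gₖ x^(qᵏ−1) for
-- all k.  Raising these equations to the powers λₖ and multiplying gives
-- FI_λ(ψ) = FI_λ(φ) xᵈ when λ ∈ B, so that isomorphic modules have the same
-- invariants.  Conversely, let y be an isomorphism over an extension ι and
-- FI_λ(φ) = FI_λ(ψ) zᵈ with z ∈ L*.  Then (ι(z) y)ᵈ = 1, and as d divides
-- qᵏ−1 for k ∈ I, y may be replaced by z⁻¹ ∈ L*.

module Submission where

open import Defs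
open import Algebra.Apartness.Bundles using (HeytingCommutativeRing; HeytingField)
open import Algebra.Bundles using (AbelianGroup; CommutativeRing; RawRing)
import Algebra.Apartness.Properties.HeytingCommutativeRing as HeytingProperties
import Algebra.Definitions.RawSemiring as Powers
open import Algebra.Morphism.Structures using (IsMagmaHomomorphism; IsRingHomomorphism)
import Algebra.Properties.AbelianGroup as AbelianGroupProperties
import Algebra.Properties.CommutativeMonoid.Mult as CommutativeMultiples
import Algebra.Properties.CommutativeSemigroup as CommutativeSemigroupProperties
open import Data.Fin.Base using (Fin)
open import Data.Integer.Base as ℤ using (ℤ; +_; -[1+_])
import Data.Integer.Properties as ℤ
open import Data.Integer.Tactic.RingSolver using (solve-∀)
open import Data.List.Base using (List; []; _∷_; applyUpTo; foldr; map)
open import Data.List.Membership.Propositional using (_∈_; _∉_)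
open import Data.List.Membership.Propositional.Properties
  using (∈-applyUpTo⁺; ∈-filter⁺)
open import Data.List.Properties using (filter-≐)
open import Data.List.Relation.Unary.All as All using (All; []; _∷_; reduce)
open import Data.List.Relation.Unary.All.Properties using (all-filter)
open import Data.List.Relation.Unary.Any using (here; there)
open import Data.List.Relation.Unary.AllPairs using ([]; _∷_)
open import Data.List.Relation.Unary.Unique.Propositional using (Unique)
import Data.List.Relation.Unary.Unique.Propositional.Properties as Unique
open import Data.Nat.Base as ℕ using (ℕ; zero; suc; NonZero; _∸_; s≤s)
open import Data.Nat.Divisibility using (_∣_; divides; ∣-trans; _∣0)
open import Data.Nat.GCD
  using (gcd; gcd[m,n]∣m; gcd[m,n]∣n; gcd-GCD; module Bézout)
import Data.Nat.Properties as ℕ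
open import Data.Product.Base using (∃; ∃₂; _×_; _,_; proj₁; proj₂)
open import Data.Sum.Base using (_⊎_; inj₁; inj₂)
open import Function.Base using (_∘_; case_of_)
open import Function.Bundles using (Inverse; _⇔_; mk⇔; Equivalence)
open import Level using (Level)
open import Relation.Binary.Bundles using (Setoid)
open import Relation.Binary.PropositionalEquality as ≡ using (_≡_; _≢_)
import Relation.Binary.Reasoning.Setoid as SetoidReasoning
open import Relation.Nullary.Decidable using (yes; no)
open import Relation.Nullary.Negation using (¬_; contradiction)
open import Relation.Unary using (Pred)

private
  variable
    a b c a′ b′ c′ a″ b″ c″ p ℓ ℓ₁ ℓ₂ : Level

-- Bézout's identity

weightedSum : (ℕ → ℤ) → (ℕ → ℕ) → List ℕ → ℤ
weightedSum λs n ks = foldr ℤ._+_ (+ 0) (map (λ k → λs k ℤ.* + n k) ks)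

gcds : (ℕ → ℕ) → List ℕ → ℕ
gcds n ks = foldr gcd 0 (map n ks)

gcds∣ : ∀ n {k ks} → k ∈ ks → gcds n ks ∣ n k
gcds∣ n (here ≡.refl) = gcd[m,n]∣m _ _
gcds∣ n {ks = j ∷ _} (there k∈ks) = ∣-trans (gcd[m,n]∣n (n j) _) (gcds∣ n k∈ks)

-- Bézout's identity over ℕ has two subtraction-free forms, according to which coefficient is
-- negative. Both reduce to this one after exchanging the two summands.
ℕ-identity⇒ℤ-identity : ∀ e x m y n → e ℕ.+ y ℕ.* n ≡ x ℕ.* m →
                        + e ≡ + x ℤ.* + m ℤ.+ (ℤ.- + y) ℤ.* + n
ℕ-identity⇒ℤ-identity e x m y n eq = begin
  + e                                           ≡⟨ cancel (+ e) (+ y) (+ n) ⟩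
  (+ e ℤ.+ + y ℤ.* + n) ℤ.+ -yn                 ≡⟨ ≡.cong (λ i → (+ e ℤ.+ i) ℤ.+ -yn) (ℤ.pos-* y n) ⟨
  + (e ℕ.+ y ℕ.* n) ℤ.+ -yn                     ≡⟨ ≡.cong (λ i → + i ℤ.+ -yn) eq ⟩
  + (x ℕ.* m) ℤ.+ -yn                           ≡⟨ ≡.cong (ℤ._+ -yn) (ℤ.pos-* x m) ⟩
  + x ℤ.* + m ℤ.+ -yn                           ∎
  where
  open ≡.≡-Reasoning
  -yn = (ℤ.- + y) ℤ.* + n
  cancel : ∀ e y n → e ≡ (e ℤ.+ y ℤ.* n) ℤ.+ (ℤ.- y) ℤ.* n
  cancel = solve-∀

gcd-bezout : ∀ m n → ∃₂ λ u v → + gcd m n ≡ u ℤ.* + m ℤ.+ v ℤ.* + n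
gcd-bezout m n with Bézout.identity (gcd-GCD m n)
... | Bézout.+- x y eq = + x , ℤ.- + y , ℕ-identity⇒ℤ-identity (gcd m n) x m y n eq
... | Bézout.-+ x y eq = ℤ.- + x , + y ,
  ≡.trans (ℕ-identity⇒ℤ-identity (gcd m n) y n x m eq) (ℤ.+-comm (+ y ℤ.* + n) _)

-- Rescales the coefficients of a tail. The hypothesis is confined to the entries of `ks`, because
-- at a new head the coefficient is chosen separately.
weightedSum-scale : ∀ {λs μs} v n {ks} → All (λ k → μs k ≡ v ℤ.* λs k) ks →
                    weightedSum μs n ks ≡ v ℤ.* weightedSum λs n ks
weightedSum-scale v n [] = ≡.sym (ℤ.*-zeroʳ v)
weightedSum-scale {λs} {μs} v n {k ∷ ks} (eq ∷ eqs) = begin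
  μs k ℤ.* + n k ℤ.+ weightedSum μs n ks
    ≡⟨ ≡.cong₂ (λ i j → i ℤ.* + n k ℤ.+ j) eq (weightedSum-scale v n eqs) ⟩
  v ℤ.* λs k ℤ.* + n k ℤ.+ v ℤ.* weightedSum λs n ks
    ≡⟨ ≡.cong (ℤ._+ _) (ℤ.*-assoc v (λs k) (+ n k)) ⟩
  v ℤ.* (λs k ℤ.* + n k) ℤ.+ v ℤ.* weightedSum λs n ks
    ≡⟨ ℤ.*-distribˡ-+ v _ _ ⟨
  v ℤ.* (λs k ℤ.* + n k ℤ.+ weightedSum λs n ks) ∎
  where open ≡.≡-Reasoning

-- Induction on the list: Bézout for `n j` and the gcd of the tail gives `u` and `v`; the head
-- receives `u` and the old coefficients are multiplied by `v`. Coefficients are indexed by entries,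
-- not positions, so `Unique` ensures that the value chosen at `j` disturbs nothing in the tail.
bezout-list : ∀ n {ks} → Unique ks → ∃ λ (λs : ℕ → ℤ) →
              (∀ k → k ∉ ks → λs k ≡ + 0) × + gcds n ks ≡ weightedSum λs n ks
bezout-list n [] = (λ _ → + 0) , (λ _ _ → ≡.refl) , ≡.refl
bezout-list n {j ∷ ks} (j≢ks ∷ ks!)
  with λs , support , bezout ← bezout-list n ks!
  with u , v , gcd≡ ← gcd-bezout (n j) (gcds n ks)
  = μs , μs-support , (begin
    + gcd (n j) (gcds n ks)                             ≡⟨ gcd≡ ⟩
    u ℤ.* + n j ℤ.+ v ℤ.* + gcds n ks                 ≡⟨ ≡.cong (λ i → u ℤ.* + n j ℤ.+ v ℤ.* i) bezout ⟩
    u ℤ.* + n j ℤ.+ v ℤ.* weightedSum λs n ks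
      ≡⟨ ≡.cong₂ (λ i i′ → i ℤ.* + n j ℤ.+ i′) μs-here
           (weightedSum-scale v n (All.map μs-there j≢ks)) ⟨
    μs j ℤ.* + n j ℤ.+ weightedSum μs n ks            ∎)
  where
  open ≡.≡-Reasoning

  μs : ℕ → ℤ
  μs k with k ℕ.≟ j
  ... | yes _ = u
  ... | no  _ = v ℤ.* λs k

  μs-here : μs j ≡ u
  μs-here with j ℕ.≟ j
  ... | yes _   = ≡.refl
  ... | no j≢j  = contradiction ≡.refl j≢j

  μs-there : ∀ {k} → j ≢ k → μs k ≡ v ℤ.* λs k
  μs-there {k} j≢k with k ℕ.≟ j
  ... | yes k≡j = contradiction (≡.sym k≡j) j≢k
  ... | no  _   = ≡.refl

  μs-support : ∀ k → k ∉ j ∷ ks → μs k ≡ + 0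
  μs-support k k∉ with k ℕ.≟ j
  ... | yes k≡j = contradiction (here k≡j) k∉
  ... | no  _   = ≡.trans (≡.cong (v ℤ.*_) (support k (k∉ ∘ there))) (ℤ.*-zeroʳ v)

-- Integral powers in abelian groups

module IntegralPowers (G : AbelianGroup c ℓ) where

  open AbelianGroup G
  open AbelianGroupProperties G
  open CommutativeMultiples commutativeMonoid
    using (×-congʳ; ×-homo-+; ×-assocˡ; ×-distrib-+) renaming (_×_ to infixr 8 _×ᴳ_)
  open CommutativeSemigroupProperties
    commutativeSemigroup using (interchange)
  open SetoidReasoning setoid

  private
    infixr 9 _^_
    _^_ : Carrier → ℤ → Carrier
    _^_ = zpow group

  ×-ε : ∀ n → n ×ᴳ ε ≈ ε
  ×-ε zero    = refl
  ×-ε (suc n) = trans (identityˡ _) (×-ε n)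

  ×-⁻¹ : ∀ n x → n ×ᴳ (x ⁻¹) ≈ (n ×ᴳ x) ⁻¹
  ×-⁻¹ n x = inverseʳ-unique _ _ (begin
    n ×ᴳ x ∙ n ×ᴳ (x ⁻¹) ≈⟨ ×-distrib-+ x (x ⁻¹) n ⟨
    n ×ᴳ (x ∙ x ⁻¹)      ≈⟨ ×-congʳ n (inverseʳ x) ⟩
    n ×ᴳ ε               ≈⟨ ×-ε n ⟩
    ε                    ∎)

  ×-∣-ε : ∀ {m n x} → m ∣ n → m ×ᴳ x ≈ ε → n ×ᴳ x ≈ ε
  ×-∣-ε {m} {x = x} (divides k ≡.refl) mx≈ε = begin
    (k ℕ.* m) ×ᴳ x   ≈⟨ ×-assocˡ x k m ⟨
    k ×ᴳ m ×ᴳ x      ≈⟨ ×-congʳ k mx≈ε ⟩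
    k ×ᴳ ε           ≈⟨ ×-ε k ⟩
    ε                ∎

  zpow-cong : ∀ i {x y} → x ≈ y → x ^ i ≈ y ^ i
  zpow-cong (+ n)    x≈y = ×-congʳ n x≈y
  zpow-cong -[1+ n ] x≈y = ⁻¹-cong (×-congʳ (suc n) x≈y)

  zpow-∙ : ∀ x y i → (x ∙ y) ^ i ≈ x ^ i ∙ y ^ i
  zpow-∙ x y (+ n)    = ×-distrib-+ x y n
  zpow-∙ x y -[1+ n ] =
    trans (⁻¹-cong (×-distrib-+ x y (suc n))) (sym (⁻¹-∙-comm _ _))

  zpow-neg : ∀ x i → x ^ (ℤ.- i) ≈ (x ^ i) ⁻¹
  zpow-neg x (+ zero)  = sym ε⁻¹≈ε
  zpow-neg x (+ suc n) = refl
  zpow-neg x -[1+ n ]  = sym (⁻¹-involutive _)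

  -- Addition in ℤ computes to `⊖` for opposite signs, so this settles the mixed cases of `zpow-+`.
  -- Each induction step cancels one `x` against one `x ⁻¹`.
  zpow-⊖ : ∀ x m n → x ^ (m ℤ.⊖ n) ≈ m ×ᴳ x ∙ (n ×ᴳ x) ⁻¹
  zpow-⊖ x m zero = sym (trans (∙-congˡ ε⁻¹≈ε) (identityʳ _))
  zpow-⊖ x zero (suc n) = sym (identityˡ _)
  zpow-⊖ x (suc m) (suc n) = begin
    x ^ (suc m ℤ.⊖ suc n)                    ≡⟨ ≡.cong (x ^_) (ℤ.[1+m]⊖[1+n]≡m⊖n m n) ⟩
    x ^ (m ℤ.⊖ n)                            ≈⟨ zpow-⊖ x m n ⟩
    m ×ᴳ x ∙ (n ×ᴳ x) ⁻¹                     ≈⟨ identityˡ _ ⟨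
    ε ∙ (m ×ᴳ x ∙ (n ×ᴳ x) ⁻¹)               ≈⟨ ∙-congʳ (inverseʳ x) ⟨
    (x ∙ x ⁻¹) ∙ (m ×ᴳ x ∙ (n ×ᴳ x) ⁻¹)      ≈⟨ interchange _ _ _ _ ⟩
    suc m ×ᴳ x ∙ (x ⁻¹ ∙ (n ×ᴳ x) ⁻¹)        ≈⟨ ∙-congˡ (⁻¹-∙-comm _ _) ⟩
    suc m ×ᴳ x ∙ (suc n ×ᴳ x) ⁻¹             ∎

  zpow-+ : ∀ x i j → x ^ (i ℤ.+ j) ≈ x ^ i ∙ x ^ j
  zpow-+ x (+ m)    (+ n)    = ×-homo-+ x m n
  zpow-+ x (+ m)    -[1+ n ] = zpow-⊖ x m (suc n)
  zpow-+ x -[1+ m ] (+ n)    = trans (zpow-⊖ x n (suc m)) (comm _ _)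
  zpow-+ x -[1+ m ] -[1+ n ] = begin
    -- Both offsets of `-[1+_]` are collected in front of the sum; one of them is moved back to `n`.
    (suc (suc (m ℕ.+ n)) ×ᴳ x) ⁻¹          ≡⟨ ≡.cong (λ k → (suc k ×ᴳ x) ⁻¹) (ℕ.+-suc m n) ⟨
    ((suc m ℕ.+ suc n) ×ᴳ x) ⁻¹            ≈⟨ ⁻¹-cong (×-homo-+ x (suc m) (suc n)) ⟩
    (suc m ×ᴳ x ∙ suc n ×ᴳ x) ⁻¹           ≈⟨ ⁻¹-∙-comm _ _ ⟨
    (suc m ×ᴳ x) ⁻¹ ∙ (suc n ×ᴳ x) ⁻¹      ∎

  zpow-*-+ : ∀ x m n → x ^ (+ m ℤ.* + n) ≈ m ×ᴳ n ×ᴳ x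
  zpow-*-+ x m n = begin
    x ^ (+ m ℤ.* + n)  ≡⟨ ≡.cong (x ^_) (ℤ.pos-* m n) ⟨
    (m ℕ.* n) ×ᴳ x     ≈⟨ ×-assocˡ x m n ⟨
    m ×ᴳ n ×ᴳ x        ∎

  zpow-* : ∀ x i n → x ^ (i ℤ.* + n) ≈ (n ×ᴳ x) ^ i
  zpow-* x (+ m)    n = zpow-*-+ x m n
  zpow-* x -[1+ m ] n = begin
    x ^ (-[1+ m ] ℤ.* + n)        ≡⟨ ≡.cong (x ^_) (ℤ.neg-distribˡ-* (+ suc m) (+ n)) ⟨
    x ^ (ℤ.- (+ suc m ℤ.* + n))   ≈⟨ zpow-neg x (+ suc m ℤ.* + n) ⟩
    (x ^ (+ suc m ℤ.* + n)) ⁻¹    ≈⟨ ⁻¹-cong (zpow-*-+ x (suc m) n) ⟩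
    (suc m ×ᴳ n ×ᴳ x) ⁻¹          ∎

  -- When `P k` says that gₖ is invertible and `f` pairs gₖ with that proof, this unfolds to `FI`. A
  -- general `f` also covers the images of the gₖ in an extension.
  powProduct : (ℕ → ℤ) → {P : Pred ℕ p} → (∀ {k} → P k → Carrier) →
               ∀ {ks} → All P ks → Carrier
  powProduct λs f ps = foldr _∙_ ε (reduce (λ {k} pk → f pk ^ λs k) ps)

  -- The powers of `x` collected from the factors have exponents `λs k` times `n k`, which add up to
  -- the weighted sum. The two lists are related by an equality because the supports of two modules
  -- are different filters, only propositionally equal.
  powProduct-twist :
    ∀ λs n x {P : Pred ℕ p} {P′ : Pred ℕ p}
    (f : ∀ {k} → P k → Carrier) (f′ : ∀ {k} → P′ k → Carrier) →
    (∀ {k} (pk : P k) (pk′ : P′ k) → f′ pk′ ≈ f pk ∙ n k ×ᴳ x) →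
    ∀ {ks ks′} → ks ≡ ks′ → (ps : All P ks) (ps′ : All P′ ks′) →
    powProduct λs f′ ps′ ≈ powProduct λs f ps ∙ x ^ weightedSum λs n ks
  powProduct-twist λs n x f f′ f′≈f ≡.refl [] [] = sym (identityˡ ε)
  powProduct-twist λs n x f f′ f′≈f {k ∷ ks} ≡.refl (pk ∷ ps) (pk′ ∷ ps′) = begin
    f′ pk′ ^ λs k ∙ powProduct λs f′ ps′
      ≈⟨ ∙-cong (zpow-cong (λs k) (f′≈f pk pk′))
                (powProduct-twist λs n x f f′ f′≈f ≡.refl ps ps′) ⟩
    (f pk ∙ n k ×ᴳ x) ^ λs k ∙ (powProduct λs f ps ∙ x ^ s)
      ≈⟨ ∙-congʳ (zpow-∙ _ _ (λs k)) ⟩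
    (f pk ^ λs k ∙ (n k ×ᴳ x) ^ λs k) ∙ (powProduct λs f ps ∙ x ^ s)
      ≈⟨ interchange _ _ _ _ ⟩
    (f pk ^ λs k ∙ powProduct λs f ps) ∙ ((n k ×ᴳ x) ^ λs k ∙ x ^ s)
      ≈⟨ ∙-congˡ (∙-congʳ (zpow-* x (λs k) (n k))) ⟨
    (f pk ^ λs k ∙ powProduct λs f ps) ∙ (x ^ (λs k ℤ.* + n k) ∙ x ^ s)
      ≈⟨ ∙-congˡ (zpow-+ x (λs k ℤ.* + n k) s) ⟨
    (f pk ^ λs k ∙ powProduct λs f ps) ∙ x ^ (λs k ℤ.* + n k ℤ.+ s) ∎
    where
    s = weightedSum λs n ks

-- Integral powers under group homomorphisms

module IntegralPowersHomomorphism
  (G : AbelianGroup a ℓ₁) (H : AbelianGroup b ℓ₂)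
  (h : AbelianGroup.Carrier G → AbelianGroup.Carrier H)
  (h-isHom : IsMagmaHomomorphism (AbelianGroup.rawMagma G) (AbelianGroup.rawMagma H) h)
  where

  private
    module G = AbelianGroup G
    module H = AbelianGroup H
  open IsMagmaHomomorphism h-isHom renaming (⟦⟧-cong to h-cong; homo to h-homo)
  open AbelianGroupProperties H using (identityˡ-unique; inverseʳ-unique)
  open CommutativeMultiples G.commutativeMonoid using () renaming (_×_ to infixr 8 _×ᴳ_)
  open CommutativeMultiples H.commutativeMonoid using () renaming (_×_ to infixr 8 _×ᴴ_)
  private
    module PG = IntegralPowers G
    module PH = IntegralPowers H
  open H using (_≈_; trans; sym)

  -- The image of the identity is idempotent, and cancellation in `H` does the rest. Hence
  -- compatibility with products is all that is asked of `h`.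
  ε-homo : h G.ε ≈ H.ε
  ε-homo = identityˡ-unique _ _ (trans (sym (h-homo G.ε G.ε)) (h-cong (G.identityˡ _)))

  ⁻¹-homo : ∀ x → h (x G.⁻¹) ≈ h x H.⁻¹
  ⁻¹-homo x = inverseʳ-unique _ _
    (trans (sym (h-homo _ _)) (trans (h-cong (G.inverseʳ x)) ε-homo))

  ×-homo : ∀ n x → h (n ×ᴳ x) ≈ n ×ᴴ h x
  ×-homo zero    x = ε-homo
  ×-homo (suc n) x = trans (h-homo _ _) (H.∙-congˡ (×-homo n x))

  zpow-homo : ∀ x i → h (zpow G.group x i) ≈ zpow H.group (h x) i
  zpow-homo x (+ n)    = ×-homo n x
  zpow-homo x -[1+ n ] = trans (⁻¹-homo _) (H.⁻¹-cong (×-homo (suc n) x))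

  powProduct-homo :
    ∀ λs {P : Pred ℕ p} (f : ∀ {k} → P k → G.Carrier) {ks} (ps : All P ks) →
    h (PG.powProduct λs f ps) ≈ PH.powProduct λs (λ {k} pk → h (f {k} pk)) ps
  powProduct-homo λs f []                = ε-homo
  powProduct-homo λs f {k ∷ _} (pk ∷ ps) = trans (h-homo _ _)
    (H.∙-cong (zpow-homo (f pk) (λs k)) (powProduct-homo λs f ps))

-- Coefficients of twisted polynomials

module _ (R : RawRing a ℓ₁) (S : CommutativeRing b ℓ₂)
         {σ : RawRing.Carrier R → RawRing.Carrier R}
         {σ′ : CommutativeRing.Carrier S → CommutativeRing.Carrier S} where

  open CommutativeRing S
  private
    module Rσ  = SkewPolynomial R σ
    module Sσ′ = SkewPolynomial rawRing σ′

  coeff-map : ∀ h → h (RawRing.0# R) ≈ 0# →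
              ∀ f k → Sσ′.coeff (map h f) k ≈ h (Rσ.coeff f k)
  coeff-map h h0≈0 []      k       = sym h0≈0
  coeff-map h h0≈0 (x ∷ f) zero    = refl
  coeff-map h h0≈0 (x ∷ f) (suc k) = coeff-map h h0≈0 f k

-- Conjugation of a twisted polynomial by a unit

module Conjugation (q : ℕ) .{{_ : NonZero q}} (K : HeytingField c ℓ₁ ℓ₂) where

  private
    R : CommutativeRing c ℓ₁
    R = HeytingCommutativeRing.commutativeRing (HeytingField.heytingCommutativeRing K)
  open CommutativeRing R
  open Powers (RawRing.rawSemiring (fieldRing K)) using (_^_)
  open CommutativeMultiples *-commutativeMonoid using (×-congʳ; ×-assocˡ)
  open Twisted q K using (coeff; C) renaming (_+_ to _+ᴾ_; _*_ to _*ᴾ_)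
  open AbelianGroup (K ˣ) using () renaming (Carrier to Unit; _⁻¹ to _⁻¹ᵁ; inverseˡ to inverseˡᵁ)
  open CommutativeMultiples (AbelianGroup.commutativeMonoid (K ˣ)) using ()
    renaming (_×_ to infixr 8 _×ᵁ_)
  open SetoidReasoning setoid

  0^ : ∀ n .{{_ : NonZero n}} → 0# ^ n ≈ 0#
  0^ (suc n) = zeroˡ _

  coeff-+ : ∀ f g k → coeff (f +ᴾ g) k ≈ coeff f k + coeff g k
  coeff-+ []      g       k       = sym (+-identityˡ _)
  coeff-+ (x ∷ f) []      k       = sym (+-identityʳ _)
  coeff-+ (x ∷ f) (y ∷ g) zero    = refl
  coeff-+ (x ∷ f) (y ∷ g) (suc k) = coeff-+ f g k

  coeff-∷* : ∀ x f g k →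
    coeff ((x ∷ f) *ᴾ g) k ≈ x * coeff g k + coeff (f *ᴾ (0# ∷ map (_^ q) g)) k
  coeff-∷* x f g k = trans (coeff-+ (map (x *_) g) _ k)
    (+-congʳ (coeff-map rawRing R (x *_) (zeroʳ x) g k))

  shift-cong : ∀ {f g} → (∀ k → coeff f k ≈ coeff g k) →
               ∀ k → coeff (0# ∷ f) k ≈ coeff (0# ∷ g) k
  shift-cong f≈g zero    = refl
  shift-cong f≈g (suc k) = f≈g k

  twist-cong : ∀ {f g} → (∀ k → coeff f k ≈ coeff g k) →
               ∀ k → coeff (map (_^ q) f) k ≈ coeff (map (_^ q) g) k
  twist-cong {f} {g} f≈g k = begin
    coeff (map (_^ q) f) k  ≈⟨ coeff-map rawRing R (_^ q) (0^ q) f k ⟩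
    coeff f k ^ q           ≈⟨ ×-congʳ q (f≈g k) ⟩
    coeff g k ^ q           ≈⟨ coeff-map rawRing R (_^ q) (0^ q) g k ⟨
    coeff (map (_^ q) g) k  ∎

  -- Twisting a shifted polynomial produces the entry `0# ^ q`, which is only equivalent to `0#`;
  -- this allows the replacement inside a product.
  *-congˡᴾ : ∀ f {g h} → (∀ k → coeff g k ≈ coeff h k) →
             ∀ k → coeff (f *ᴾ g) k ≈ coeff (f *ᴾ h) k
  *-congˡᴾ []      g≈h k = refl
  *-congˡᴾ (x ∷ f) {g} {h} g≈h k = begin
    coeff ((x ∷ f) *ᴾ g) k                                  ≈⟨ coeff-∷* x f g k ⟩
    x * coeff g k + coeff (f *ᴾ (0# ∷ map (_^ q) g)) k
      ≈⟨ +-cong (*-congˡ (g≈h k)) (*-congˡᴾ f (shift-cong (twist-cong {g} {h} g≈h)) k) ⟩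
    x * coeff h k + coeff (f *ᴾ (0# ∷ map (_^ q) h)) k      ≈⟨ coeff-∷* x f h k ⟨
    coeff ((x ∷ f) *ᴾ h) k                                  ∎

  -- This is f (g τ) = (f g) τ: prepending a zero is multiplication by τ on the right, and it
  -- commutes with the twisting of coefficients since 0^q = 0.
  coeff-*-shift : ∀ f g k → coeff (f *ᴾ (0# ∷ g)) k ≈ coeff (0# ∷ (f *ᴾ g)) k
  coeff-*-shift []      g zero    = refl
  coeff-*-shift []      g (suc k) = refl
  coeff-*-shift (x ∷ f) g k = begin
    coeff ((x ∷ f) *ᴾ (0# ∷ g)) k                                          ≈⟨ coeff-∷* x f (0# ∷ g) k ⟩
    x * coeff (0# ∷ g) k + coeff (f *ᴾ (0# ∷ 0# ^ q ∷ map (_^ q) g)) k     ≈⟨ +-congˡ (*-congˡᴾ f (shift-cong 0^q∷) k) ⟩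
    x * coeff (0# ∷ g) k + coeff (f *ᴾ (0# ∷ 0# ∷ map (_^ q) g)) k         ≈⟨ +-congˡ (coeff-*-shift f (0# ∷ map (_^ q) g) k) ⟩
    x * coeff (0# ∷ g) k + coeff (0# ∷ (f *ᴾ (0# ∷ map (_^ q) g))) k       ≈⟨ unshift k ⟩
    coeff (0# ∷ ((x ∷ f) *ᴾ g)) k                                          ∎
    where
    0^q∷ : ∀ k → coeff (0# ^ q ∷ map (_^ q) g) k ≈ coeff (0# ∷ map (_^ q) g) k
    0^q∷ zero    = 0^ q
    0^q∷ (suc k) = refl

    unshift : ∀ k →
      x * coeff (0# ∷ g) k + coeff (0# ∷ (f *ᴾ (0# ∷ map (_^ q) g))) k
        ≈ coeff (0# ∷ ((x ∷ f) *ᴾ g)) k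
    unshift zero    = trans (+-identityʳ _) (zeroʳ x)
    unshift (suc k) = sym (coeff-∷* x f g k)

  -- The rule τᵏ x = x^(qᵏ) τᵏ. Moving one τ past `x` leaves `x ^ q`, to which the induction
  -- hypothesis applies.
  coeff-*C : ∀ f x k → coeff (f *ᴾ C x) k ≈ coeff f k * x ^ (q ℕ.^ k)
  coeff-*C []      x k = sym (zeroˡ _)
  coeff-*C (y ∷ f) x k = begin
    coeff ((y ∷ f) *ᴾ C x) k                              ≈⟨ coeff-∷* y f (C x) k ⟩
    y * coeff (C x) k + coeff (f *ᴾ (0# ∷ C (x ^ q))) k   ≈⟨ +-congˡ (coeff-*-shift f (C (x ^ q)) k) ⟩
    y * coeff (C x) k + coeff (0# ∷ (f *ᴾ C (x ^ q))) k   ≈⟨ byDegree k ⟩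
    coeff (y ∷ f) k * x ^ (q ℕ.^ k)                       ∎
    where
    byDegree : ∀ k → y * coeff (C x) k + coeff (0# ∷ (f *ᴾ C (x ^ q))) k
                   ≈ coeff (y ∷ f) k * x ^ (q ℕ.^ k)
    byDegree zero    = trans (+-identityʳ _) (*-congˡ (sym (*-identityʳ x)))
    byDegree (suc k) = begin
      y * 0# + coeff (f *ᴾ C (x ^ q)) k      ≈⟨ +-congʳ (zeroʳ y) ⟩
      0# + coeff (f *ᴾ C (x ^ q)) k          ≈⟨ +-identityˡ _ ⟩
      coeff (f *ᴾ C (x ^ q)) k               ≈⟨ coeff-*C f (x ^ q) k ⟩
      coeff f k * (x ^ q) ^ (q ℕ.^ k)        ≈⟨ *-congˡ (×-assocˡ x (q ℕ.^ k) q) ⟩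
      coeff f k * x ^ (q ℕ.^ k ℕ.* q)        ≡⟨ ≡.cong (λ n → coeff f k * x ^ n) (ℕ.*-comm (q ℕ.^ k) q) ⟩
      coeff f k * x ^ (q ℕ.^ suc k)          ∎

  proj₁-× : ∀ n (x : Unit) → proj₁ (n ×ᵁ x) ≡ proj₁ x ^ n
  proj₁-× zero    x = ≡.refl
  proj₁-× (suc n) x = ≡.cong (proj₁ x *_) (proj₁-× n x)

  -- Of the qᵏ factors `x` arising on the right, one cancels against `x ⁻¹` on the left. The
  -- remaining power is taken in the unit group, where the invariants live.
  coeff-conjugate : ∀ f (x : Unit) k →
    coeff (C (proj₁ (x ⁻¹ᵁ)) *ᴾ f *ᴾ C (proj₁ x)) k
      ≈ coeff f k * proj₁ ((q ℕ.^ k ∸ 1) ×ᵁ x)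
  coeff-conjugate f x k = begin
    coeff (C y *ᴾ f *ᴾ C z) k             ≈⟨ coeff-*C (C y *ᴾ f) z k ⟩
    coeff (C y *ᴾ f) k * z ^ (q ℕ.^ k)    ≈⟨ *-congʳ (trans (coeff-∷* y [] f k) (+-identityʳ _)) ⟩
    y * coeff f k * z ^ (q ℕ.^ k)         ≡⟨ ≡.cong (λ n → y * coeff f k * z ^ n) (ℕ.suc-pred (q ℕ.^ k)) ⟨
    y * coeff f k * (z * z ^ n)           ≈⟨ *-congʳ (*-comm y _) ⟩
    coeff f k * y * (z * z ^ n)           ≈⟨ *-assoc _ _ _ ⟩
    coeff f k * (y * (z * z ^ n))         ≈⟨ *-congˡ (*-assoc _ _ _) ⟨
    coeff f k * (y * z * z ^ n)           ≈⟨ *-congˡ (*-congʳ (inverseˡᵁ x)) ⟩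
    coeff f k * (1# * z ^ n)              ≈⟨ *-congˡ (*-identityˡ _) ⟩
    coeff f k * z ^ n                     ≡⟨ ≡.cong (coeff f k *_) (proj₁-× n x) ⟨
    coeff f k * proj₁ (n ×ᵁ x)            ∎
    where
    y = proj₁ (x ⁻¹ᵁ)
    z = proj₁ x
    n = q ℕ.^ k ∸ 1
    -- The truncated subtraction in `n` is a true predecessor only because qᵏ is positive.
    instance
      q^k≢0 : NonZero (q ℕ.^ k)
      q^k≢0 = ℕ.m^n≢0 q k

-- Extensions of fields

module ExtensionProperties {K : HeytingField c ℓ₁ ℓ₂} (E : Extension K a b p) where

  open Extension E
  private
    module K  = HeytingField K
    module E  = HeytingField extField
    module Kˣ = AbelianGroup (K ˣ)
    module Eˣ = AbelianGroup (extField ˣ)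
    module EP = HeytingProperties E.heytingCommutativeRing
  open IsRingHomomorphism ι-isHom public
    using () renaming (⟦⟧-cong to ι-cong; +-homo to ι-+; *-homo to ι-*; 0#-homo to ι-0; 1#-homo to ι-1; -‿homo to ι-neg)

  -- Apartness is invertibility of the difference, and a ring homomorphism carries inverses to
  -- inverses.
  ι-# : ∀ {x y} → x K.# y → ι x E.# ι y
  ι-# {x} {y} x#y with z , z[x-y]≈1 , _ ← K.#⇒invertible x#y =
    EP.invertibleˡ⇒# (ι z , (begin
      ι z E.* (ι x E.- ι y)      ≈⟨ E.*-congˡ (E.+-congˡ (ι-neg y)) ⟨
      ι z E.* (ι x E.+ ι (K.- y)) ≈⟨ E.*-congˡ (ι-+ x (K.- y)) ⟨
      ι z E.* ι (x K.- y)        ≈⟨ ι-* z (x K.- y) ⟨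
      ι (z K.* (x K.- y))        ≈⟨ ι-cong z[x-y]≈1 ⟩
      ι K.1#                     ≈⟨ ι-1 ⟩
      E.1#                       ∎))
    where open SetoidReasoning E.setoid

  -- By tightness it suffices to refute `x # y`, which `ι` would preserve.
  ι-injective : ∀ {x y} → ι x E.≈ ι y → x K.≈ y
  ι-injective {x} {y} ιx≈ιy =
    proj₁ (K.tight x y) λ x#y → proj₂ (E.tight (ι x) (ι y)) ιx≈ιy (ι-# x#y)

  ιˣ : Kˣ.Carrier → Eˣ.Carrier
  ιˣ (x , x#0) = ι x , EP.#-congˡ ι-0 (ι-# x#0)

  ιˣ-isHom : IsMagmaHomomorphism Kˣ.rawMagma Eˣ.rawMagma ιˣ
  ιˣ-isHom = record
    { isRelHomomorphism = record { cong = ι-cong }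
    ; homo              = λ _ _ → ι-* _ _
    }

  open IntegralPowersHomomorphism (K ˣ) (extField ˣ) ιˣ ιˣ-isHom public

-- Drinfeld modules

order≢0 : ∀ (𝔽 : FiniteField a b c) → NonZero (FiniteField.order 𝔽)
order≢0 𝔽 = nonempty (Inverse.to (IsFinite.enumeration F.isFinite) F.0#)
  where
  module F = FiniteField 𝔽
  nonempty : ∀ {n} → Fin n → NonZero n
  nonempty {suc _} _ = _

module DrinfeldModules {𝔽 : FiniteField a b c} (L : FiniteAField 𝔽 a′ b′ c′) where

  private
    module L  = FiniteAField L
    module Lˣ = AbelianGroup (L.heytingField ˣ)

    q : ℕ
    q = FiniteField.order 𝔽

    instance
      q≢0 : NonZero q
      q≢0 = order≢0 𝔽

    n : ℕ → ℕ
    n k = q ℕ.^ k ∸ 1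

  open DrinfeldModule using (g; φT; degree)

  ¬#0⇒≈0 : ∀ {x} → ¬ (x L.# L.0#) → x L.≈ L.0#
  ¬#0⇒≈0 {x} = proj₁ (L.tight x L.0#)

  -- The case distinction for descending a twist: divisibility of `n k` by `d` serves the first two
  -- cases, vanishing of the coefficient the third.
  support? : ∀ {r} (φ : DrinfeldModule L r) k →
             k ≡ 0 ⊎ k ∈ I φ ⊎ g φ k L.≈ L.0#
  support? φ zero = inj₁ ≡.refl
  support? {r} φ (suc k) with g φ (suc k) L.#0? | k ℕ.<? r
  ... | no gₖ≈0  | _       = inj₂ (inj₂ (¬#0⇒≈0 gₖ≈0))
  ... | yes gₖ#0 | yes k<r =
    inj₂ (inj₁ (∈-filter⁺ (λ k → g φ k L.#0?) (∈-applyUpTo⁺ suc k<r) gₖ#0))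
  -- Here `suc k` exceeds `r`, so the degree bound gives the third alternative.
  ... | yes gₖ#0 | no k≮r  = inj₂ (inj₂ (degree φ (suc k) (s≤s (ℕ.≮⇒≥ k≮r))))

  d∣n : ∀ {r} (φ : DrinfeldModule L r) {k} → k ≡ 0 ⊎ k ∈ I φ → d φ ∣ n k
  -- The exponent q⁰ - 1 is zero.
  d∣n φ (inj₁ ≡.refl) = d φ ∣0
  d∣n φ (inj₂ k∈I)    = gcds∣ n k∈I

  I! : ∀ {r} (φ : DrinfeldModule L r) → Unique (I φ)
  I! {r} φ = Unique.filter⁺ (λ k → g φ k L.#0?)
    (Unique.applyUpTo⁺₁ suc r λ i<j _ → ℕ.<⇒≢ (s≤s i<j))

  -- Nonemptiness of B is what leads from agreement at every λ to agreement at some λ.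
  ∃InB : ∀ {r} (φ : DrinfeldModule L r) → ∃ λ λs → InB φ λs
  ∃InB φ with λs , support , bezout ← bezout-list n (I! φ) =
    λs , record { support = support ; bezout = bezout }

  InB-resp : ∀ {r} {φ ψ : DrinfeldModule L r} → I φ ≡ I ψ →
             ∀ {λs} → InB φ λs → InB ψ λs
  InB-resp eq {λs} λs∈B = record
    { support = ≡.subst (λ ks → ∀ k → k ∉ ks → λs k ≡ + 0) eq (InB.support λs∈B)
    ; bezout  = ≡.subst (λ ks → + gcds n ks ≡ weightedSum λs n ks) eq (InB.bezout λs∈B)
    }

  -- Twists over an extension field and their descent

  module _ (E : Extension L.heytingField a″ b″ c″) where

    open Extension E
    open ExtensionProperties E
    private
      module E  = HeytingField extField
      module Eˣ = AbelianGroup (extField ˣ)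
      module EP = HeytingProperties E.heytingCommutativeRing
      module EI = IntegralPowers (extField ˣ)
      module EA = AbelianGroupProperties (extField ˣ)
    open Conjugation q extField using (coeff-conjugate)
    open CommutativeMultiples Eˣ.commutativeMonoid using (×-congʳ; ×-distrib-+)
      renaming (_×_ to infixr 8 _×ᴱ_)
    open CommutativeMultiples Lˣ.commutativeMonoid using () renaming (_×_ to infixr 8 _×ᴸ_)
    open SetoidReasoning E.setoid

    private
      coeff-ι : ∀ f k → Twisted.coeff q extField (map ι f) k
                          E.≈ ι (Twisted.coeff q L.heytingField f k)
      coeff-ι = coeff-map (fieldRing L.heytingField)
        (HeytingCommutativeRing.commutativeRing E.heytingCommutativeRing) ι ι-0

    -- The coefficientwise form of ψ_T = x⁻¹ φ_T x. Every `k` is included, as equality of twisted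
    -- polynomials compares all coefficients.
    IsTwist : ∀ {r} → DrinfeldModule L r → DrinfeldModule L r → Eˣ.Carrier → Set b″
    IsTwist φ ψ x = ∀ k → ι (g ψ k) E.≈ ι (g φ k) E.* proj₁ (n k ×ᴱ x)

    isomorphic⇔twist : ∀ {r} {φ ψ : DrinfeldModule L r} →
                       IsomorphicOver E φ ψ ⇔ ∃ (IsTwist φ ψ)
    isomorphic⇔twist {φ = φ} {ψ} = mk⇔
      (λ (x , iso) → x , λ k → begin
        ι (g ψ k)                                   ≈⟨ coeff-ι (φT ψ) k ⟨
        coeff (map ι (φT ψ)) k                      ≈⟨ iso k ⟩
        coeff (C _ * map ι (φT φ) * C (proj₁ x)) k  ≈⟨ conjugate x k ⟩
        ι (g φ k) E.* proj₁ (n k ×ᴱ x)              ∎)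
      (λ (x , twist) → x , λ k → begin
        coeff (map ι (φT ψ)) k                      ≈⟨ coeff-ι (φT ψ) k ⟩
        ι (g ψ k)                                   ≈⟨ twist k ⟩
        ι (g φ k) E.* proj₁ (n k ×ᴱ x)              ≈⟨ conjugate x k ⟨
        coeff (C _ * map ι (φT φ) * C (proj₁ x)) k  ∎)
      where
      open Twisted q extField using (coeff; C; _*_)

      conjugate : ∀ x k → coeff (C (proj₁ (x Eˣ.⁻¹)) * map ι (φT φ) * C (proj₁ x)) k
                            E.≈ ι (g φ k) E.* proj₁ (n k ×ᴱ x)
      conjugate x k = E.trans (coeff-conjugate (map ι (φT φ)) x k)
        (E.*-congʳ (coeff-ι (φT φ) k))

    module _ {r} {φ ψ : DrinfeldModule L r} {x : Eˣ.Carrier} (twist : IsTwist φ ψ x) where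

      private
        twist-ι≈0 : ∀ k → ι (g φ k) E.≈ E.0# → ι (g ψ k) E.≈ E.0#
        twist-ι≈0 k eq = E.trans (twist k) (E.trans (E.*-congʳ eq) (E.zeroˡ _))

      twist-≈0 : ∀ k → g φ k L.≈ L.0# → g ψ k L.≈ L.0#
      twist-≈0 k eq = ι-injective
        (E.trans (twist-ι≈0 k (E.trans (ι-cong eq) ι-0)) (E.sym ι-0))

      -- The twist relation yields apartness only in the extension. Invertibility is decidable in
      -- the finite field L, and a vanishing gₖ′ would contradict that apartness.
      twist-# : ∀ k → g φ k L.# L.0# → g ψ k L.# L.0#
      twist-# k gφ#0 with g ψ k L.#0?
      ... | yes gψ#0 = gψ#0
      ... | no ¬gψ#0 = contradiction
        (EP.#-congʳ (E.sym (twist k))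
          (EP.x#0y#0→xy#0 (proj₂ (ιˣ (g φ k , gφ#0))) (proj₂ (n k ×ᴱ x))))
        (proj₂ (E.tight _ _) (E.trans (ι-cong (¬#0⇒≈0 ¬gψ#0)) ι-0))

      twist-#⁻ : ∀ k → g ψ k L.# L.0# → g φ k L.# L.0#
      twist-#⁻ k gψ#0 with g φ k L.#0?
      ... | yes gφ#0 = gφ#0
      ... | no ¬gφ#0 = contradiction gψ#0
        (proj₂ (L.tight _ _) (twist-≈0 k (¬#0⇒≈0 ¬gφ#0)))

      twist-I : I φ ≡ I ψ
      twist-I = filter-≐ (λ k → g φ k L.#0?) (λ k → g ψ k L.#0?)
        ((λ {k} → twist-# k) , (λ {k} → twist-#⁻ k)) (applyUpTo suc r)

      -- Both invariants are pushed into the extension, where `x` lives, and compared there factor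
      -- by factor.
      twist-FI : ∀ {λs} → InB φ λs → ιˣ (FI ψ λs) Eˣ.≈ ιˣ (FI φ λs) Eˣ.∙ d φ ×ᴱ x
      twist-FI {λs} λs∈B = begin
        proj₁ (ιˣ (FI ψ λs))
          ≈⟨ powProduct-homo λs (λ {k} p → g ψ k , p) ψ#0 ⟩
        proj₁ (EI.powProduct λs (λ {k} p → ιˣ (g ψ k , p)) ψ#0)
          ≈⟨ EI.powProduct-twist λs n x (λ {k} p → ιˣ (g φ k , p)) (λ {k} p → ιˣ (g ψ k , p))
               (λ {k} _ _ → twist k) twist-I φ#0 ψ#0 ⟩
        proj₁ (EI.powProduct λs (λ {k} p → ιˣ (g φ k , p)) φ#0)
          E.* proj₁ (zpow Eˣ.group x (weightedSum λs n (I φ)))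
          ≈⟨ E.*-congʳ (powProduct-homo λs (λ {k} p → g φ k , p) φ#0) ⟨
        proj₁ (ιˣ (FI φ λs)) E.* proj₁ (zpow Eˣ.group x (weightedSum λs n (I φ)))
          -- Membership in B turns the exponent into `+ d φ`, at which `zpow` computes to the
          -- natural power.
          ≡⟨ ≡.cong (λ i → proj₁ (ιˣ (FI φ λs)) E.* proj₁ (zpow Eˣ.group x i)) (InB.bezout λs∈B) ⟨
        proj₁ (ιˣ (FI φ λs)) E.* proj₁ (d φ ×ᴱ x) ∎
        where
        φ#0 = all-filter (λ k → g φ k L.#0?) (applyUpTo suc r)
        ψ#0 = all-filter (λ k → g ψ k L.#0?) (applyUpTo suc r)

      -- The element `z ⁻¹` of L* need not map to `x`: the two differ by a `d`-th root of unity,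
      -- invisible to exponents divisible by `d`. Where gₖ = 0 both sides vanish.
      descend : ∀ {λs} → InB φ λs → SameFIAt φ ψ λs →
                ∃ λ z → ∀ k → g ψ k L.≈ g φ k L.* proj₁ (n k ×ᴸ z)
      descend {λs} λs∈B (z , FIφ≈FIψ∙zᵈ) = z Lˣ.⁻¹ , λ k → case support? φ k of λ where
          (inj₁ k≡0)           → twist-z k (d∣n φ (inj₁ k≡0))
          (inj₂ (inj₁ k∈I))    → twist-z k (d∣n φ (inj₂ k∈I))
          (inj₂ (inj₂ gφ≈0))   → L.trans (twist-≈0 k gφ≈0)
            (L.sym (L.trans (L.*-congʳ gφ≈0) (L.zeroˡ _)))
        where
        [zx]ᵈ≈1 : d φ ×ᴱ (ιˣ z Eˣ.∙ x) Eˣ.≈ Eˣ.ε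
        -- Multiplying the image of FI_λ(ψ) by zᵈ gives that of FI_λ(φ), and multiplying by xᵈ
        -- returns to FI_λ(ψ); this common factor is then cancelled.
        [zx]ᵈ≈1 = EA.identityʳ-unique (ιˣ (FI ψ λs)) (d φ ×ᴱ (ιˣ z Eˣ.∙ x)) (begin
          proj₁ (ιˣ (FI ψ λs) Eˣ.∙ d φ ×ᴱ (ιˣ z Eˣ.∙ x))
            ≈⟨ E.*-congˡ (×-distrib-+ (ιˣ z) x (d φ)) ⟩
          proj₁ (ιˣ (FI ψ λs) Eˣ.∙ (d φ ×ᴱ ιˣ z Eˣ.∙ d φ ×ᴱ x))
            ≈⟨ E.*-assoc _ _ _ ⟨
          proj₁ (ιˣ (FI ψ λs) Eˣ.∙ d φ ×ᴱ ιˣ z Eˣ.∙ d φ ×ᴱ x)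
            ≈⟨ E.*-congʳ (E.*-congˡ (×-homo (d φ) z)) ⟨
          proj₁ (ιˣ (FI ψ λs) Eˣ.∙ ιˣ (d φ ×ᴸ z) Eˣ.∙ d φ ×ᴱ x)
            ≈⟨ E.*-congʳ (ι-* _ _) ⟨
          proj₁ (ιˣ (FI ψ λs Lˣ.∙ d φ ×ᴸ z) Eˣ.∙ d φ ×ᴱ x)
            ≈⟨ E.*-congʳ (ι-cong FIφ≈FIψ∙zᵈ) ⟨
          proj₁ (ιˣ (FI φ λs) Eˣ.∙ d φ ×ᴱ x)
            ≈⟨ twist-FI λs∈B ⟨
          proj₁ (ιˣ (FI ψ λs)) ∎)

        xⁿ≈z⁻ⁿ : ∀ {m} → d φ ∣ m → m ×ᴱ x Eˣ.≈ ιˣ (m ×ᴸ (z Lˣ.⁻¹))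
        xⁿ≈z⁻ⁿ {m} d∣m = begin
          proj₁ (m ×ᴱ x)               ≈⟨ EA.inverseʳ-unique (m ×ᴱ ιˣ z) (m ×ᴱ x)
                                            (E.trans (E.sym (×-distrib-+ (ιˣ z) x m))
                                              (EI.×-∣-ε {x = ιˣ z Eˣ.∙ x} d∣m [zx]ᵈ≈1)) ⟩
          proj₁ ((m ×ᴱ ιˣ z) Eˣ.⁻¹)    ≈⟨ EI.×-⁻¹ m (ιˣ z) ⟨
          proj₁ (m ×ᴱ (ιˣ z Eˣ.⁻¹))      ≈⟨ ×-congʳ m (⁻¹-homo z) ⟨
          proj₁ (m ×ᴱ ιˣ (z Lˣ.⁻¹))    ≈⟨ ×-homo m (z Lˣ.⁻¹) ⟨
          proj₁ (ιˣ (m ×ᴸ (z Lˣ.⁻¹)))    ∎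

        twist-z : ∀ k → d φ ∣ n k → g ψ k L.≈ g φ k L.* proj₁ (n k ×ᴸ (z Lˣ.⁻¹))
        -- The relation between elements of L is checked in the extension and brought back by
        -- injectivity.
        twist-z k d∣nₖ = ι-injective (begin
          ι (g ψ k)                                    ≈⟨ twist k ⟩
          ι (g φ k) E.* proj₁ (n k ×ᴱ x)               ≈⟨ E.*-congˡ (xⁿ≈z⁻ⁿ d∣nₖ) ⟩
          ι (g φ k) E.* ι (proj₁ (n k ×ᴸ (z Lˣ.⁻¹)))     ≈⟨ ι-* _ _ ⟨
          ι (g φ k L.* proj₁ (n k ×ᴸ (z Lˣ.⁻¹)))         ∎)

    base-change : ∀ {r} {φ ψ : DrinfeldModule L r} z →
                  (∀ k → g ψ k L.≈ g φ k L.* proj₁ (n k ×ᴸ z)) → IsTwist φ ψ (ιˣ z)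
    base-change z twist k =
      E.trans (ι-cong (twist k)) (E.trans (ι-* _ _) (E.*-congˡ (×-homo (n k) z)))

theorem2p1 :
    ∀ {a b c a′ b′ c′ a″ b″ c″ : Level}
    (𝔽 : FiniteField a b c) (L : FiniteAField 𝔽 a′ b′ c′)
    (Lsep : SeparableClosure (FiniteAField.heytingField L) a″ b″ c″)
    (r : ℕ) .{{_ : NonZero r}} (φ ψ : DrinfeldModule L r) →
    let isoOverL    = IsomorphicOver (trivialExtension (FiniteAField.heytingField L)) φ ψ
        isoOverLsep = IsomorphicOver (SeparableClosure.extension Lsep) φ ψ
        condition₂  = isoOverLsep × ∃ λ (λs : ℕ → ℤ) → InB φ λs × SameFIAt φ ψ λs
        condition₃  = isoOverLsep × SameFI φ ψ
    in (isoOverL ⇔ condition₂) × (isoOverL ⇔ condition₃)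
theorem2p1 𝔽 L Lsep r φ ψ =
  -- Both equivalences follow from the cycle (i) ⇒ (iii) ⇒ (ii) ⇒ (i).
  mk⇔ (3⇒2 ∘ 1⇒3) 2⇒1 , mk⇔ 1⇒3 (2⇒1 ∘ 3⇒2)
  where
  open DrinfeldModules L
  K = FiniteAField.heytingField L
  E = SeparableClosure.extension Lsep
  module overK = Equivalence (isomorphic⇔twist (trivialExtension K) {φ = φ} {ψ})
  module overE = Equivalence (isomorphic⇔twist E {φ = φ} {ψ})

  1⇒3 : IsomorphicOver (trivialExtension K) φ ψ → IsomorphicOver E φ ψ × SameFI φ ψ
  1⇒3 iso with x , twist ← overK.to iso =
    overE.from (_ , base-change E {φ = φ} {ψ} x twist) ,
    (λ λs → mk⇔ (InB-resp {φ = φ} {ψ} I≡) (InB-resp {φ = ψ} {φ} (≡.sym I≡))) ,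
    -- Over the trivial extension `ι` is the identity, so `twist-FI` is already a relation in L*. It
    -- expresses FI_λ(ψ) through FI_λ(φ), hence the symmetry.
    λ λs λs∈B → Setoid.sym ((K ˣ) modPowers d φ) {FI ψ λs} {FI φ λs}
      (x , twist-FI (trivialExtension K) {φ = φ} {ψ} twist λs∈B)
    where
    I≡ : I φ ≡ I ψ
    I≡ = twist-I (trivialExtension K) {φ = φ} {ψ} twist

  3⇒2 : IsomorphicOver E φ ψ × SameFI φ ψ →
        IsomorphicOver E φ ψ × ∃ λ λs → InB φ λs × SameFIAt φ ψ λs
  3⇒2 (iso , _ , sameFI) with λs , λs∈B ← ∃InB φ = iso , λs , λs∈B , sameFI λs λs∈B

  2⇒1 : (IsomorphicOver E φ ψ × ∃ λ λs → InB φ λs × SameFIAt φ ψ λs) →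
        IsomorphicOver (trivialExtension K) φ ψ
  2⇒1 (iso , λs , λs∈B , same) with x , twist ← overE.to iso =
    overK.from (descend E {φ = φ} {ψ} twist λs∈B same)
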